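{- Let $G$ be a finite, simple, connected graph and let $k\ge 0$. If $G$ contains a $k$-supported cycle, then $\sigma(G)\ge k$.
   Context: For a spanning tree $T$ of $G$, $\mathrm{Stretch}(G:T)=\max_{uv\in E(G)} d_T(u,v)$, and the stretch of $G$ is $\sigma(G)=\min_T \mathrm{Stretch}(G:T)$, the minimum over all spanning trees $T$ of $G$; $d_G,d_T$ denote graph distances. A cycle $C$ in $G$ is called $k$-supported (for a real number $k$) if $C$ can be partitioned into three edge-disjoint paths $I_1,I_2,I_3$, with $I_1\cap I_2$, $I_2\cap I_3$ and $I_3\cap I_1$ each consisting of exactly one vertex, such that for every triple of vertices $(u_1,u_2,u_3)$ with $u_i\in V(I_i)$ for $i=1,2,3$ we have $\max_{i,j\in\{1,2,3\}} d_G(u_i,u_j)\ge k$. -}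

module Defs where

open import Data.Empty using (⊥)
open import Data.Fin using (Fin)
open import Data.Fin.Properties using (any?) renaming (_≟_ to _≟ᶠ_)
open import Data.Integer using (+_)
open import Data.List using (List; []; _∷_; map; foldr; filter; allFin; cartesianProduct; drop)
open import Data.List.Membership.Propositional using (_∈_)
open import Data.List.Relation.Unary.Unique.Propositional using (Unique)
open import Data.Nat using (ℕ; zero; suc; z≤n; s≤s; _⊔_) renaming (_≤_ to _≤ⁿ_)
open import Data.Nat.Properties using (suc-injective)
open import Data.Product using (Σ; ∃; ∃!; _×_; _,_; proj₁; uncurry)
open import Data.Rational using (ℚ; _+_; 0ℚ; 1ℚ; -_) renaming (_<_ to _<ᵠ_)
open import Data.Rational.Literals using (fromℤ)
open import Data.Rational.Properties using (<-dense; <-trans; <-asym; ≮⇒≥; ≤-<-trans; _<?_; +-monoʳ-<; +-identityʳ)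
open import Data.Sum using (_⊎_; inj₁; inj₂)
open import Function using (_⇔_; mk⇔; _∘_)
open import Relation.Binary.Construct.Closure.ReflexiveTransitive using (Star; ε; _◅_)
open import Relation.Binary.PropositionalEquality using (_≡_; _≢_; refl; cong; subst)
open import Relation.Nullary using (¬_; Dec; yes; no; contradiction)
open import Relation.Nullary.Decidable using (map′; _×-dec_; from-yes)

-- Two-sided Dedekind cuts: lower q means q < x, upper q means x < q.
record ℝ : Set₁ where
  field
    lower upper     : ℚ → Set
    lower-inhabited : ∃ lower
    upper-inhabited : ∃ upper
    lower-rounded   : ∀ q → lower q ⇔ (∃ λ r → q <ᵠ r × lower r)
    upper-rounded   : ∀ q → upper q ⇔ (∃ λ r → r <ᵠ q × upper r)
    disjoint        : ∀ q → lower q → upper q → ⊥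
    located         : ∀ q r → q <ᵠ r → lower q ⊎ upper r

infix 4 _≤_
_≤_ : ℝ → ℝ → Set
x ≤ y = ∀ q → ℝ.lower x q → ℝ.lower y q

fromℚ : ℚ → ℝ
fromℚ p = record
  { lower           = _<ᵠ p
  ; upper           = p <ᵠ_
  ; lower-inhabited = p + - 1ℚ , subst (p + - 1ℚ <ᵠ_) (+-identityʳ p) (+-monoʳ-< p (from-yes (- 1ℚ <? 0ℚ)))
  ; upper-inhabited = p + 1ℚ , subst (_<ᵠ p + 1ℚ) (+-identityʳ p) (+-monoʳ-< p (from-yes (0ℚ <? 1ℚ)))
  ; lower-rounded   = λ q → mk⇔ <-dense (λ (r , q<r , r<p) → <-trans q<r r<p)
  ; upper-rounded   = λ q → mk⇔ (λ p<q → let (r , p<r , r<q) = <-dense p<q in r , r<q , p<r)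
                                (λ (r , r<q , p<r) → <-trans p<r r<q)
  ; disjoint        = λ q q<p p<q → <-asym q<p p<q
  ; located         = loc
  }
  where
  loc : ∀ q r → q <ᵠ r → q <ᵠ p ⊎ p <ᵠ r
  loc q r q<r with q <? p
  ... | yes q<p = inj₁ q<p
  ... | no  q≮p = inj₂ (≤-<-trans (≮⇒≥ q≮p) q<r)

fromℕ : ℕ → ℝ
fromℕ m = fromℚ (fromℤ (+ m))

least : {P : ℕ → Set} → (∀ m → Dec (P m)) → ∀ m → P m → ∃ λ l → P l × (∀ j → P j → l ≤ⁿ j)
least P? m pm with P? 0
... | yes p0 = 0 , p0 , λ _ _ → z≤n
least P? zero    p0 | no ¬p0 = contradiction p0 ¬p0
least P? (suc m) pm | no ¬p0 with least (P? ∘ suc) m pm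
... | l , pl , minimal = suc l , pl , λ { zero p0 → contradiction p0 ¬p0 ; (suc j) pj → s≤s (minimal j pj) }

-- The empty list has maximum 0, which is harmless for lists of distances.
maximum : List ℕ → ℕ
maximum = foldr _⊔_ 0

record Graph (n : ℕ) : Set₁ where
  field
    Adj    : Fin n → Fin n → Set
    adj?   : ∀ u v → Dec (Adj u v)
    symm   : ∀ {u v} → Adj u v → Adj v u
    irrefl : ∀ {v} → ¬ Adj v v

module _ {n : ℕ} (G : Graph n) where
  open Graph G

  Walk : Fin n → Fin n → Set
  Walk = Star Adj

  Connected : Set
  Connected = ∀ u v → Walk u v

-- A walk in G is an element of Star (Adj G); these depend only on the adjacency relation.
module _ {n : ℕ} {Adj : Fin n → Fin n → Set} where

  length : ∀ {u v} → Star Adj u v → ℕ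
  length ε       = 0
  length (_ ◅ w) = suc (length w)

  vertices : ∀ {u v} → Star Adj u v → List (Fin n)
  vertices {u} ε       = u ∷ []
  vertices {u} (_ ◅ w) = u ∷ vertices w

  steps : ∀ {u v} → Star Adj u v → List (Fin n × Fin n)
  steps ε                     = []
  steps {u} (_◅_ {j = x} _ w) = (u , x) ∷ steps w

  -- The undirected edge xy is traversed by w, in either direction.
  EdgeOf : ∀ {u v} → Star Adj u v → Fin n → Fin n → Set
  EdgeOf w x y = (x , y) ∈ steps w ⊎ (y , x) ∈ steps w

module _ {n : ℕ} (G : Graph n) where
  open Graph G

  record Path : Set where
    field
      {source target} : Fin n
      walk            : Walk G source target
      simple          : Unique (vertices walk)

  -- The base vertex occurs at both ends of the vertex list, so one copy is dropped.
  record Cycle : Set where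
    field
      {base} : Fin n
      walk   : Walk G base base
      long   : 3 ≤ⁿ length walk
      simple : Unique (drop 1 (vertices walk))

  walkOfLength? : ∀ u v m → Dec (Σ (Walk G u v) λ w → length w ≡ m)
  walkOfLength? u v zero =
    map′ (λ { refl → ε , refl }) (λ { (ε , _) → refl ; (_ ◅ _ , ()) }) (u ≟ᶠ v)
  walkOfLength? u v (suc m) =
    map′ (λ { (_ , a , w , eq) → a ◅ w , cong suc eq })
         (λ { (ε , ()) ; (a ◅ w , eq) → _ , a , w , suc-injective eq })
         (any? λ x → adj? u x ×-dec walkOfLength? x v m)

  dist : Connected G → Fin n → Fin n → ℕ
  dist conn u v = proj₁ (least (walkOfLength? u v) (length (conn u v)) (conn u v , refl))

  edges : List (Fin n × Fin n)
  edges = filter (uncurry adj?) (cartesianProduct (allFin n) (allFin n))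

module _ {n : ℕ} (G : Graph n) where
  open Graph G

  record SpanningTree : Set₁ where
    field
      tree      : Graph n
      subgraph  : ∀ {u v} → Graph.Adj tree u v → Adj u v
      connected : Connected tree
      acyclic   : ¬ Cycle tree

  Stretch : SpanningTree → ℕ
  Stretch T = maximum (map (uncurry (dist tree connected)) (edges G))
    where open SpanningTree T using (tree; connected)

  -- s = σ(G), the minimum of Stretch(G:T) over all spanning trees T.
  IsStretch : ℕ → Set₁
  IsStretch s = (∃ λ T → Stretch T ≡ s) × (∀ T → s ≤ⁿ Stretch T)

  record Tripartition (C : Cycle G) : Set where
    field
      I : Fin 3 → Path G

    _∈V_ : Fin n → Fin 3 → Set
    v ∈V i = v ∈ vertices (Path.walk (I i))

    E : Fin 3 → Fin n → Fin n → Set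
    E i = EdgeOf (Path.walk (I i))

    field
      vertex-cover  : ∀ v → v ∈ vertices (Cycle.walk C) ⇔ (∃ λ i → v ∈V i)
      edge-cover    : ∀ x y → EdgeOf (Cycle.walk C) x y ⇔ (∃ λ i → E i x y)
      edge-disjoint : ∀ i j → i ≢ j → ∀ x y → E i x y → ¬ E j x y
      intersection  : ∀ i j → i ≢ j → ∃! _≡_ (λ v → v ∈V i × v ∈V j)

  maxDist : Connected G → (Fin 3 → Fin n) → ℕ
  maxDist conn u =
    maximum (map (λ (i , j) → dist G conn (u i) (u j)) (cartesianProduct (allFin 3) (allFin 3)))

  Supported : Connected G → ℝ → Cycle G → Set
  Supported conn k C = Σ (Tripartition C) λ P → let open Tripartition P in
    ∀ (u : Fin 3 → Fin n) → (∀ i → u i ∈V i) → k ≤ fromℕ (maxDist conn u)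

{-# OPTIONS --safe #-}
-- Let T be a spanning tree of stretch σ and let a, b, c be the three vertices in which
-- the paths I₁, I₂, I₃ meet pairwise.  Their median m in T lies on every T-walk between
-- two of them.  Replacing each edge of Iᵢ by a T-geodesic between its ends turns Iᵢ into
-- such a T-walk, so m lies on one of these geodesics; its length is at most σ, hence an
-- end uᵢ of that edge satisfies 2 d_T(uᵢ, m) ≤ σ.  The triple (u₁, u₂, u₃) then has
-- pairwise distances at most σ.
module Submission where

open import Defs
open import Data.Fin using (Fin)
open import Data.Fin.Patterns using (0F; 1F; 2F)
open import Data.Fin.Properties using () renaming (_≟_ to _≟ᶠ_)
open import Data.Integer using (+_; +≤+)
import Data.Integer.Properties as ℤ
open import Data.List using ([]; _∷_; map; allFin; cartesianProduct)
import Data.List.Membership.DecPropositional as DecMembership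
open import Data.List.Membership.Propositional using (_∈_; _∉_)
open import Data.List.Membership.Propositional.Properties using (∈-allFin; ∈-cartesianProduct⁺; ∈-filter⁺; ∈-map⁺)
open import Data.List.Relation.Binary.Subset.Propositional using (_⊆_)
open import Data.List.Relation.Unary.All using ([])
open import Data.List.Relation.Unary.All.Properties using (¬Any⇒All¬; All¬⇒¬Any)
open import Data.List.Relation.Unary.AllPairs using ([]; _∷_)
open import Data.List.Relation.Unary.Any using (here; there)
open import Data.List.Relation.Unary.Unique.Propositional using (Unique)
open import Data.Nat using (ℕ; suc; _+_; z≤n; s≤s) renaming (_≤_ to _≤ⁿ_)
open import Data.Nat.Properties using (≤-trans; ≤-total; ≤-reflexive; m≤m⊔n; m≤n⊔m; ⊔-lub; +-monoʳ-≤; +-monoˡ-≤; +-suc; +-identityʳ)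
open import Data.Product using (Σ; ∃; ∃-syntax; _×_; _,_; proj₁; proj₂; uncurry)
open import Data.Rational using (*≤*)
open import Data.Rational.Properties using (<-≤-trans)
open import Data.Sum using (_⊎_; inj₁; inj₂; [_,_]′)
open import Function using (_∘_; id)
open import Relation.Binary.Construct.Closure.ReflexiveTransitive using (Star; ε; _◅_; _◅◅_; reverse; revApp) renaming (map to mapWalk)
open import Relation.Binary.Definitions using (Symmetric)
open import Relation.Binary.PropositionalEquality using (_≡_; _≢_; refl; sym; trans; cong; subst)
open import Relation.Nullary using (¬_; yes; no; contradiction)

-- Maxima and elementary inequalities

∈⇒≤maximum : ∀ {m xs} → m ∈ xs → m ≤ⁿ maximum xs
∈⇒≤maximum {xs = x ∷ xs} (here refl) = m≤m⊔n x (maximum xs)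
∈⇒≤maximum {xs = x ∷ xs} (there m∈)  = ≤-trans (∈⇒≤maximum m∈) (m≤n⊔m x (maximum xs))

maximum-map≤ : ∀ {A : Set} {s} (f : A → ℕ) → (∀ x → f x ≤ⁿ s) → ∀ xs → maximum (map f xs) ≤ⁿ s
maximum-map≤ f f≤ []       = z≤n
maximum-map≤ f f≤ (x ∷ xs) = ⊔-lub (f≤ x) (maximum-map≤ f f≤ xs)

fromℕ-mono : ∀ {m s} → m ≤ⁿ s → fromℕ m ≤ fromℕ s
-- Both rationals have denominator 1, so `*≤*` asks for `m * 1 ≤ s * 1` in the integers; hence the
-- factor `+ 1`.
fromℕ-mono m≤s q q<m = <-≤-trans q<m (*≤* (ℤ.*-monoʳ-≤-nonNeg (+ 1) (+≤+ m≤s)))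

smallerHalf : ∀ k l {s} → k + l ≤ⁿ s → k + k ≤ⁿ s ⊎ l + l ≤ⁿ s
smallerHalf k l k+l≤s with ≤-total k l
... | inj₁ k≤l = inj₁ (≤-trans (+-monoʳ-≤ k k≤l) k+l≤s)
... | inj₂ l≤k = inj₂ (≤-trans (+-monoˡ-≤ l l≤k) k+l≤s)

sumOfHalves : ∀ k l {s} → k + k ≤ⁿ s → l + l ≤ⁿ s → k + l ≤ⁿ s
sumOfHalves k l 2k≤s 2l≤s with ≤-total k l
... | inj₁ k≤l = ≤-trans (+-monoˡ-≤ l k≤l) 2l≤s
... | inj₂ l≤k = ≤-trans (+-monoʳ-≤ k l≤k) 2k≤s

-- Walks: splitting, loop erasure, reversal

module _ {n : ℕ} {R : Fin n → Fin n → Set} where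
  open DecMembership (_≟ᶠ_ {n}) using (_∈?_)

  source∈ : ∀ {u v} (w : Star R u v) → u ∈ vertices w
  source∈ ε       = here refl
  source∈ (_ ◅ _) = here refl

  ∈-◅◅⁻ : ∀ {u v x z} (p : Star R u v) (q : Star R v x) →
          z ∈ vertices (p ◅◅ q) → z ∈ vertices p ⊎ z ∈ vertices q
  ∈-◅◅⁻ ε       q z∈         = inj₂ z∈
  ∈-◅◅⁻ (_ ◅ _) q (here eq)  = inj₁ (here eq)
  ∈-◅◅⁻ (_ ◅ p) q (there z∈) with ∈-◅◅⁻ p q z∈
  ... | inj₁ z∈p = inj₁ (there z∈p)
  ... | inj₂ z∈q = inj₂ z∈q

  length-◅◅ : ∀ {u v x} (p : Star R u v) (q : Star R v x) → length (p ◅◅ q) ≡ length p + length q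
  length-◅◅ ε       q = refl
  length-◅◅ (_ ◅ p) q = cong suc (length-◅◅ p q)

  split : ∀ {u v z} (w : Star R u v) → z ∈ vertices w →
          Σ (Star R u z) λ p → Σ (Star R z v) λ q →
            vertices p ⊆ vertices w × vertices q ⊆ vertices w × length p + length q ≡ length w
  split ε       (here refl) = ε , ε , id , id , refl
  split (e ◅ w) (here refl) = ε , e ◅ w , (λ { (here eq) → here eq }) , id , refl
  split (e ◅ w) (there z∈) with split w z∈
  ... | p , q , p⊆ , q⊆ , eq =
    e ◅ p , q , (λ { (here eq′) → here eq′ ; (there y∈) → there (p⊆ y∈) }) , there ∘ q⊆ , cong suc eq

  simpleSuffix : ∀ {u v z} (w : Star R u v) → Unique (vertices w) → z ∈ vertices w →
                 Σ (Star R z v) (Unique ∘ vertices)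
  simpleSuffix ε       uniq       (here refl) = ε , uniq
  simpleSuffix (e ◅ w) uniq       (here refl) = e ◅ w , uniq
  simpleSuffix (e ◅ w) (_ ∷ uniq) (there z∈)  = simpleSuffix w uniq z∈

  loopErase : ∀ {u v} → Star R u v → Σ (Star R u v) (Unique ∘ vertices)
  loopErase ε = ε , [] ∷ []
  loopErase {u} (e ◅ w) with loopErase w
  ... | w′ , uniq with u ∈? vertices w′
  -- The new edge starts a loop at `u`; keeping only the part of `w′` from `u` on cuts it off.
  ...   | yes u∈ = simpleSuffix w′ uniq u∈
  ...   | no  u∉ = e ◅ w′ , ¬Any⇒All¬ _ u∉ ∷ uniq

  avoid : ∀ {u v z} (w : Star R u v) → z ∉ vertices w → Star (λ x y → R x y × x ≢ z × y ≢ z) u v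
  avoid ε       z∉ = ε
  avoid (e ◅ w) z∉ =
    (e , (λ { refl → z∉ (here refl) }) , (λ { refl → z∉ (there (source∈ w)) })) ◅ avoid w (z∉ ∘ there)

  module _ (R-sym : Symmetric R) where

    ∈-revApp⁻ : ∀ {u v x z} (p : Star R u v) (q : Star R u x) →
                z ∈ vertices (revApp R-sym p q) → z ∈ vertices p ⊎ z ∈ vertices q
    ∈-revApp⁻ ε       q z∈ = inj₂ z∈
    ∈-revApp⁻ (e ◅ p) q z∈ with ∈-revApp⁻ p (R-sym e ◅ q) z∈
    ... | inj₁ z∈p         = inj₁ (there z∈p)
    -- The head of the accumulator is the far end of `e`, where `p` starts.
    ... | inj₂ (here refl) = inj₁ (there (source∈ p))
    ... | inj₂ (there z∈q) = inj₂ z∈q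

    reverse-⊆ : ∀ {u v} (w : Star R u v) → vertices (reverse R-sym w) ⊆ vertices w
    reverse-⊆ w z∈ with ∈-revApp⁻ w ε z∈
    ... | inj₁ z∈w         = z∈w
    ... | inj₂ (here refl) = source∈ w

    length-revApp : ∀ {u v x} (p : Star R u v) (q : Star R u x) →
                    length (revApp R-sym p q) ≡ length p + length q
    length-revApp ε       q = refl
    length-revApp (e ◅ p) q = trans (length-revApp p (R-sym e ◅ q)) (+-suc (length p) (length q))

    length-reverse : ∀ {u v} (w : Star R u v) → length (reverse R-sym w) ≡ length w
    length-reverse w = trans (length-revApp w ε) (+-identityʳ (length w))

    -- `u` and `v` may occur on `w` in either order, so the walk goes back from `u` to the start of
    -- `w` and then forward to `v`. It need not be simple.
    subwalk : ∀ {s t u v} (w : Star R s t) → u ∈ vertices w → v ∈ vertices w →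
              Σ (Star R u v) λ p → vertices p ⊆ vertices w
    subwalk w u∈ v∈ with split w u∈ | split w v∈
    ... | p , _ , p⊆ , _ | q , _ , q⊆ , _ =
      reverse R-sym p ◅◅ q , [ p⊆ ∘ reverse-⊆ p , q⊆ ]′ ∘ ∈-◅◅⁻ (reverse R-sym p) q

module _ {n : ℕ} {R S : Fin n → Fin n → Set} (f : ∀ {x y} → R x y → S x y) where

  vertices-map : ∀ {u v} (w : Star R u v) → vertices (mapWalk {U = S} f w) ≡ vertices w
  vertices-map ε       = refl
  vertices-map (_ ◅ w) = cong (_ ∷_) (vertices-map w)

  length-map : ∀ {u v} (w : Star R u v) → length (mapWalk {U = S} f w) ≡ length w
  length-map ε       = refl
  length-map (_ ◅ w) = cong suc (length-map w)

module _ {n : ℕ} (G : Graph n) (conn : Connected G) where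

  dist≤length : ∀ {u v} (w : Walk G u v) → dist G conn u v ≤ⁿ length w
  dist≤length {u} {v} w =
    proj₂ (proj₂ (least (walkOfLength? G u v) (length (conn u v)) (conn u v , refl))) (length w) (w , refl)

  geodesic : ∀ u v → Σ (Walk G u v) λ w → length w ≡ dist G conn u v
  geodesic u v =
    proj₁ (proj₂ (least (walkOfLength? G u v) (length (conn u v)) (conn u v , refl)))

  maxDist≤ : ∀ {s} (u : Fin 3 → Fin n) → (∀ i j → dist G conn (u i) (u j) ≤ⁿ s) → maxDist G conn u ≤ⁿ s
  maxDist≤ u dist≤ = maximum-map≤ (λ (i , j) → dist G conn (u i) (u j))
    (λ (i , j) → dist≤ i j) (cartesianProduct (allFin 3) (allFin 3))

-- Separation and medians in trees

module _ {n : ℕ} (T : Graph n) (acyclic : ¬ Cycle T) where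
  open Graph T
  open DecMembership (_≟ᶠ_ {n}) using (_∈?_)

  AdjWithout : Fin n → Fin n → Fin n → Fin n → Set
  AdjWithout x y u v = Adj u v × ¬ (u ≡ x × v ≡ y) × ¬ (u ≡ y × v ≡ x)

  -- After loop erasure the walk is not empty, and a single step would be the deleted edge; so it
  -- has at least two steps and closes up with `xy` to a cycle.
  edgeIsBridge : ∀ {x y} → Adj x y → ¬ Star (AdjWithout x y) x y
  edgeIsBridge e w with loopErase w
  ... | ε                 , _    = irrefl e
  ... | (_ , ≢xy , _) ◅ ε , _    = ≢xy (refl , refl)
  ... | w′@(_ ◅ (_ ◅ _))  , uniq = acyclic record
    { walk   = symm e ◅ mapWalk proj₁ w′
    ; long   = s≤s (s≤s (s≤s z≤n))
    -- The cycle is based at `y`, so dropping its first vertex leaves exactly the vertices of `w′`.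
    ; simple = subst Unique (sym (vertices-map proj₁ w′)) uniq
    }

  -- In a tree: `m` lies on the unique path from `s` to `t`, ends included. Quantifying over all
  -- walks makes it applicable to walks that may repeat vertices, such as `treeWalk`.
  Separates : Fin n → Fin n → Fin n → Set
  Separates m s t = (w : Walk T s t) → m ∈ vertices w

  separates-sym : ∀ {m s t} → Separates m s t → Separates m t s
  separates-sym sep w = reverse-⊆ symm w (sep (reverse symm w))

  -- The walk `p` misses `y` and so does not use the edge `xy`. A walk from `y` to `t` missing `x`
  -- would not use it either, and together they would bypass the bridge `xy`.
  separatesAcross : ∀ {x y t} → Adj x y → (p : Walk T x t) → y ∉ vertices p → Separates x y t
  separatesAcross {x} {y} e p y∉p q with x ∈? vertices q
  ... | yes x∈q = x∈q
  ... | no  x∉q = contradiction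
    (mapWalk (λ (a , u≢y , v≢y) → a , (v≢y ∘ proj₂) , (u≢y ∘ proj₁)) (avoid p y∉p)
      ◅◅ reverse (λ (a , v≢x , u≢x) → symm a , (u≢x ∘ proj₁) , (v≢x ∘ proj₂)) (avoid q x∉q))
    (edgeIsBridge e)

  -- A simple path from `x` to `t` either misses `y`, or its part from `y` on misses `x`. Both cases
  -- reduce to `separatesAcross`, the second with the edge reversed.
  sideOfEdge : ∀ {x y t} → Adj x y → Walk T x t → Separates x y t ⊎ Separates y x t
  sideOfEdge {y = y} e w with loopErase w
  ... | p , uniq with y ∈? vertices p
  ...   | no y∉p = inj₁ (separatesAcross e p y∉p)
  sideOfEdge e w | ε , _ | yes (here refl) = contradiction e irrefl
  sideOfEdge e w | _ ◅ p , _ | yes (here refl) = contradiction e irrefl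
  sideOfEdge e w | _ ◅ p , x≢p ∷ _ | yes (there y∈p) with split p y∈p
  ... | _ , q , _ , q⊆ , _ = inj₂ (separatesAcross (symm e) q (All¬⇒¬Any x≢p ∘ q⊆))

  separates-trans : ∀ {l m s t} → Separates m s t → Separates l m t → Separates l s t
  separates-trans sep sep′ w with split w (sep w)
  ... | _ , q , _ , q⊆ , _ = q⊆ (sep′ q)

  -- A walk from `x`, prefixed with the step from `y`, must meet `m`, and not at the added vertex
  -- `y`.
  separates-cons : ∀ {m x y t} → Adj x y → Separates m y t → m ≢ y → Separates m x t
  separates-cons e sep m≢y w with sep (symm e ◅ w)
  ... | here m≡y = contradiction m≡y m≢y
  ... | there m∈ = m∈

  -- `c` stands first in its two conditions because it is the end that moves, and `separates-cons`
  -- extends a separation at its first end.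
  Median : Fin n → Fin n → Fin n → Fin n → Set
  Median a b c m = Separates m a b × Separates m c a × Separates m c b

  -- The median moves with c along the walk: when the walk leaves the median y for x, either
  -- a or b lies on the side of x, and then x is the new median, or y remains the median.
  median : Connected T → ∀ {a b c} → Walk T c a → ∃ (Median a b c)
  median conn ε = _ , source∈ , source∈ , source∈
  median conn {a} {b} {x} (_◅_ {j = y} e w) with median conn {b = b} w
  ... | m , mab , mya , myb with m ≟ᶠ y
  ...   | no m≢y = m , mab , separates-cons e mya m≢y , separates-cons e myb m≢y
  ...   | yes refl with sideOfEdge e (conn x a) | sideOfEdge e (conn x b)
  ...     | inj₁ xya | _        =
    x , separates-sym (separates-trans (separates-sym mab) xya) , source∈ , source∈
  ...     | inj₂ _   | inj₁ xyb = x , separates-trans mab xyb , source∈ , source∈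
  ...     | inj₂ yxa | inj₂ yxb = y , mab , yxa , yxb

-- Vertices within half the stretch of the median

module _ {n : ℕ} (G : Graph n) (T : SpanningTree G) where
  open SpanningTree T
  private module T = Graph tree

  dist≤Stretch : ∀ {x y} → Graph.Adj G x y → dist tree connected x y ≤ⁿ Stretch G T
  dist≤Stretch {x} {y} e = ∈⇒≤maximum (∈-map⁺ (uncurry (dist tree connected))
    (∈-filter⁺ (uncurry (Graph.adj? G)) (∈-cartesianProduct⁺ (∈-allFin x) (∈-allFin y)) e))

  -- The doubled length avoids rounding when the stretch is odd.
  WithinHalfStretch : Fin n → Fin n → Set
  WithinHalfStretch m u = Σ (Walk tree u m) λ w → length w + length w ≤ⁿ Stretch G T

  treeWalk : ∀ {s t} → Walk G s t → Walk tree s t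
  treeWalk ε       = ε
  treeWalk (_ ◅ w) = proj₁ (geodesic tree connected _ _) ◅◅ treeWalk w

  nearVertex : ∀ {s t m} (w : Walk G s t) → m ∈ vertices (treeWalk w) →
               ∃[ u ] u ∈ vertices w × WithinHalfStretch m u
  -- There is no geodesic to halve, but `m` is then the only vertex of the walk.
  nearVertex ε (here refl) = _ , here refl , ε , z≤n
  nearVertex {s} (_◅_ {j = x} e w) m∈ with geodesic tree connected s x
  ... | g , |g|≡dist with ∈-◅◅⁻ g (treeWalk w) m∈
  ...   | inj₂ m∈w = let u , u∈ , near = nearVertex w m∈w in u , there u∈ , near
  ...   | inj₁ m∈g with split g m∈g
  ...     | p , q , _ , _ , |p|+|q|≡|g|
    with smallerHalf (length p) (length q)
           (≤-trans (≤-reflexive (trans |p|+|q|≡|g| |g|≡dist)) (dist≤Stretch e))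
  ...       | inj₁ short = s , here refl , p , short
  ...       | inj₂ short = x , there (source∈ w) , reverse T.symm q ,
    subst (λ l → l + l ≤ⁿ Stretch G T) (sym (length-reverse T.symm q)) short

  -- The detour through `m` is a walk in the tree, hence in `G`, and consists of two halves.
  near⇒dist≤Stretch : (conn : Connected G) → ∀ {m u v} →
                      WithinHalfStretch m u → WithinHalfStretch m v → dist G conn u v ≤ⁿ Stretch G T
  near⇒dist≤Stretch conn (p , p≤) (q , q≤) =
    ≤-trans (dist≤length G conn (mapWalk subgraph (p ◅◅ reverse T.symm q)))
      (≤-trans (≤-reflexive |walk|) (sumOfHalves (length p) (length q) p≤ q≤))
    where
    |walk| : length (mapWalk {U = Graph.Adj G} subgraph (p ◅◅ reverse T.symm q)) ≡ length p + length q
    |walk| = trans (length-map subgraph (p ◅◅ reverse T.symm q))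
      (trans (length-◅◅ p (reverse T.symm q)) (cong (λ l → length p + l) (length-reverse T.symm q)))

  module _ {C : Cycle G} (P : Tripartition G C) where
    open Tripartition P

    nearOnPath : ∀ i {s t m} → s ∈V i → t ∈V i → Separates tree acyclic m s t →
                 ∃[ u ] u ∈V i × WithinHalfStretch m u
    nearOnPath i s∈ t∈ sep with subwalk (Graph.symm G) (Path.walk (I i)) s∈ t∈
    ... | w , w⊆ with nearVertex w (sep (treeWalk w))
    ...   | u , u∈w , near = u , w⊆ u∈w , near

    nearTriple : ∃[ m ] (∀ i → ∃[ u ] u ∈V i × WithinHalfStretch m u)
    nearTriple with intersection 0F 1F (λ ()) | intersection 1F 2F (λ ()) | intersection 2F 0F (λ ())
    ... | a , (a∈0 , a∈1) , _ | b , (b∈1 , b∈2) , _ | c , (c∈2 , c∈0) , _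
      with median tree acyclic connected {b = b} (connected c a)
    -- Each path contains two of the corners `a`, `b`, `c`, and `m` separates that pair.
    ...   | m , mab , mca , mcb = m , λ
      { 0F → nearOnPath 0F c∈0 a∈0 mca
      ; 1F → nearOnPath 1F a∈1 b∈1 mab
      ; 2F → nearOnPath 2F c∈2 b∈2 mcb
      }

    closeTriple : (conn : Connected G) →
                  ∃[ u ] (∀ i → u i ∈V i) × maxDist G conn u ≤ⁿ Stretch G T
    closeTriple conn with nearTriple
    ... | m , near = proj₁ ∘ near , proj₁ ∘ proj₂ ∘ near ,
      maxDist≤ G conn (proj₁ ∘ near)
        (λ i j → near⇒dist≤Stretch conn (proj₂ (proj₂ (near i))) (proj₂ (proj₂ (near j))))

mainTheorem1 : ∀ {n : ℕ} (G : Graph n) (conn : Connected G) (k : ℝ) → fromℕ 0 ≤ k →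
    (∃ λ (C : Cycle G) → Supported G conn k C) →
    ∀ (σ : ℕ) → IsStretch G σ → k ≤ fromℕ σ
-- Matching on `refl` turns `σ` into the stretch of a tree `T` attaining it. The bounds of `k` by
-- `maxDist` and of `maxDist` by the stretch are then chained on lower cuts.
mainTheorem1 G conn k _ (C , P , supported) _ ((T , refl) , _) q q<k =
  let u , u∈ , maxDist≤Stretch = closeTriple G T P conn
  in fromℕ-mono {maxDist G conn u} {Stretch G T} maxDist≤Stretch q (supported u u∈ q q<k)
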